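{- Let $n, q \ge 1$ and $s \geq 2$ be integers. The total number $C_B(n, q, s)$ of $s$-collisions in all arrangements of $q$ numbered balls in $n$ numbered buckets is equal to $$ \sum_{\lambda} \binom{n}{\lambda_1}\left( \prod_{i=2}^{k} \binom{\lambda_{i-1}}{\lambda_i} \right) \left( \lambda_{k}\binom{k}{s} + \sum_{i=s}^{k-1} ( \lambda_{i} - \lambda_{i+1} )\binom{i}{s} \right) \left(q!\Big/ \prod_{i = 1}^{k} i^{ \lambda_i} \right), $$ where the sum is over all partitions $\lambda = (\lambda_1,\dots,\lambda_k)$ of $q$ such that $\lambda_1 \leq n$ and whose number of parts $k = |\lambda|$ satisfies $k \geq s$.
   Context: A partition $\lambda$ of a positive integer $q$ is a sequence of integers $\lambda_1 \ge \lambda_2 \ge \dots \ge \lambda_k \ge 1$ with $\sum_{i=1}^k \lambda_i = q$; $k = |\lambda|$ is the number of parts (it depends on $\lambda$). An arrangement of $q$ numbered (distinguishable) balls in $n$ numbered buckets places every ball in exactly one bucket, and the order of the balls within a bucket does not matter. That is, an arrangement is a function from the set of $q$ balls to the set of $n$ buckets. Let $s \ge 2$. A bucket containing $r$ balls contributes $\binom{r}{s}$ to the number of $s$-collisions of an arrangement (so it contributes $0$ if $r < s$). The number of $s$-collisions of an arrangement is the sum of these contributions over all $n$ buckets, and $C_B(n,q,s)$ is the sum of the numbers of $s$-collisions over all arrangements of $q$ balls in $n$ buckets. Empty products equal $1$ and empty sums equal $0$. -}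

module Defs where

open import Data.Fin.Base using (Fin)
open import Data.Fin.Properties using (_≟_)
open import Data.List.Base
  using (List; []; _∷_; length; map; concatMap; cartesianProductWith; applyUpTo; allFin; filter)
open import Data.List.Relation.Unary.All using (All; all?)
import Data.List.Relation.Unary.All.Properties as All
open import Data.List.Relation.Unary.Linked using (Linked; linked?)
open import Data.Nat.Base
open import Data.Nat.Combinatorics using (_C_)
open import Data.Nat.DivMod using (_/_)
open import Data.Nat.ListAction using (sum; product)
open import Data.Nat.ListAction.Properties using (product≢0)
open import Data.Nat.Properties using (_≥?_; _≤?_; m^n≢0) renaming (_≟_ to _≟ℕ_)
open import Data.Product.Base using (_×_; _,_)
import Data.Vec.Base as Vec
open import Data.Vec.Functional using (Vector) renaming ([] to []ᶠ; _∷_ to _∷ᶠ_)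
open import Relation.Binary.PropositionalEquality using (_≡_)
open import Relation.Nullary.Decidable using (Dec; map′; _×-dec_)

∑ : {A : Set} → List A → (A → ℕ) → ℕ
∑ xs f = sum (map f xs)

∏ : {A : Set} → List A → (A → ℕ) → ℕ
∏ xs f = product (map f xs)

infix 3 ∑ ∏
syntax ∑ xs (λ x → e) = ∑[ x ∈ xs ] e
syntax ∏ xs (λ x → e) = ∏[ x ∈ xs ] e

-- The integers a, a + 1, …, b, both ends included; empty if b < a.
⟦_⋯_⟧ : ℕ → ℕ → List ℕ
⟦ a ⋯ b ⟧ = applyUpTo (a +_) (suc b ∸ a)

-- Vector (Fin n) q unfolds to Fin q → Fin n: each ball is sent to its bucket.
Arrangement : ℕ → ℕ → Set
Arrangement n q = Vector (Fin n) q

-- Every function Fin q → Fin n, listed once (up to pointwise equality).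
arrangements : ∀ n q → List (Arrangement n q)
arrangements n zero    = []ᶠ ∷ []
arrangements n (suc q) = cartesianProductWith _∷ᶠ_ (allFin n) (arrangements n q)

load : ∀ {n q} → Arrangement n q → Fin n → ℕ
load f b = Vec.count (_≟ b) (Vec.tabulate f)

collisions : ∀ {n q} → ℕ → Arrangement n q → ℕ
collisions {n} s f = ∑[ b ∈ allFin n ] (load f b C s)

C-B : (n q s : ℕ) → ℕ
C-B n q s = ∑[ f ∈ arrangements n q ] collisions s f

record IsPartition (q : ℕ) (parts : List ℕ) : Set where
  constructor isPartition
  field
    decreasing : Linked _≥_ parts
    positive   : All (_≥ 1) parts
    sum≡       : sum parts ≡ q

isPartition? : ∀ q parts → Dec (IsPartition q parts)
isPartition? q parts =
  map′ (λ { (d , p , e) → isPartition d p e }) (λ { (isPartition d p e) → d , p , e })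
    (linked? _≥?_ parts ×-dec all? (_≥? 1) parts ×-dec (sum parts ≟ℕ q))

listsOfLength : {A : Set} → ℕ → List A → List (List A)
listsOfLength zero    xs = [] ∷ []
listsOfLength (suc k) xs = cartesianProductWith _∷_ xs (listsOfLength k xs)

-- A partition of q has at most q parts, each between 1 and q, so all partitions
-- of q are among the lists being filtered; each of these lists occurs once.
partitions : ℕ → List (List ℕ)
partitions q =
  filter (isPartition? q) (concatMap (λ k → listsOfLength k ⟦ 1 ⋯ q ⟧) ⟦ 0 ⋯ q ⟧)

-- part λs i is λᵢ, indexed from 1.  The value 0 outside 1 ≤ i ≤ k is a filler.
part : List ℕ → ℕ → ℕ
part []       _             = 0
part (x ∷ xs) zero          = 0
part (x ∷ xs) (suc zero)    = x
part (x ∷ xs) (suc (suc i)) = part xs (suc i)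

admissible : (n q s : ℕ) → List (List ℕ)
admissible n q s =
  filter (λ λs → (part λs 1 ≤? n) ×-dec (length λs ≥? s)) (partitions q)

denominator : List ℕ → ℕ
denominator λs = ∏[ i ∈ ⟦ 1 ⋯ length λs ⟧ ] (i ^ part λs i)

denominator≢0 : ∀ λs → NonZero (denominator λs)
denominator≢0 λs =
  product≢0 (All.map⁺ (All.applyUpTo⁺₂ suc (length λs) (λ i → m^n≢0 (suc i) (part λs (suc i)))))

-- For a partition λs of q with at least s parts, s ≥ 1, neither ∸ nor / truncates:
-- the parts decrease, and with mⱼ the number of buckets holding exactly j balls,
-- where λᵢ = ∑_{j ≥ i} mⱼ, the denominator equals ∏ⱼ (j !) ^ mⱼ, so the quotient
-- is a multinomial coefficient.
summand : (n q s : ℕ) → List ℕ → ℕ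
summand n q s λs =
    (n C part λs 1)
  * (∏[ i ∈ ⟦ 2 ⋯ k ⟧ ] (part λs (i ∸ 1) C part λs i))
  * (part λs k * (k C s) + (∑[ i ∈ ⟦ s ⋯ k ∸ 1 ⟧ ] ((part λs i ∸ part λs (i + 1)) * (i C s))))
  * (_/_ (q !) (denominator λs) {{denominator≢0 λs}})
  where k = length λs

{-# OPTIONS --safe #-}
-- Group the arrangements by their load vector v; q! / ∏ᵦ vᵦ! of them share a given v.  Peel load
-- vectors layer by layer: λᵢ is the number of buckets with at least i balls, and the buckets of layer i
-- are chosen among the λᵢ₋₁ buckets of layer i − 1 (λ₀ = n).  Thus (n C λ₁) ∏ (λᵢ₋₁ C λᵢ) load vectors
-- have layers λ.  They are permutations of one another, with ∏ᵦ vᵦ! = ∏ᵢ i ^ λᵢ and with λᵢ − λᵢ₊₁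
-- buckets of load exactly i.
module Submission where

open import Defs
open import Algebra.Properties.CommutativeSemigroup using (interchange)
open import Data.Bool.Base using (if_then_else_)
open import Data.Empty using (⊥)
open import Data.Fin.Base using (Fin; zero; suc)
open import Data.Fin.Properties using (_≟_)
open import Data.List.Base
  using (List; []; _∷_; _++_; length; map; concatMap; cartesianProductWith; applyUpTo; allFin;
         filter; replicate)
open import Data.List.Properties
  using (map-cong; map-∘; map-++; map-replicate; map-tabulate; map-applyUpTo)
open import Data.List.Membership.Propositional using (_∈_; find)
open import Data.List.Membership.Propositional.Properties
  using (∈-concatMap⁻; ∈-cartesianProductWith⁻; ∈-applyUpTo⁻)
open import Data.List.Relation.Binary.Permutation.Propositional using (_↭_; ↭-sym)
open import Data.List.Relation.Binary.Permutation.Propositional.Properties using (map⁺; ++⁺ˡ; shift)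
open import Data.List.Relation.Unary.All using (All; []; _∷_)
import Data.List.Relation.Unary.All.Properties as All
open import Data.List.Relation.Unary.Any using (here; there)
open import Data.List.Relation.Unary.Linked using (Linked; linked?; [-]; _∷_)
open import Data.Nat.Base
open import Data.Nat.Combinatorics
  using (_C_; nCk+nC[k+1]≡[n+1]C[k+1]; k>n⇒nCk≡0; nCk≡n!/k![n-k]!; k![n∸k]!∣n!)
open import Data.Nat.DivMod using (_/_; /-congˡ; /-congʳ; m*n/n≡m; m/n*n≡m)
open import Data.Nat.ListAction using (sum; product)
open import Data.Nat.ListAction.Properties using (sum-++; product-++; sum-↭; product-↭)
open import Data.Nat.Properties renaming (_≟_ to _≟ℕ_)
open import Data.Nat.Tactic.RingSolver using (solve-∀)
open import Data.Product.Base using (_×_; _,_; proj₂)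
import Data.Vec.Base as Vec
import Data.Vec.Properties as Vec
open import Data.Vec.Functional using () renaming ([] to []ᶠ; _∷_ to _∷ᶠ_)
open import Function.Base using (_∘_; id; flip)
open import Relation.Binary.PropositionalEquality
  using (_≡_; _≗_; refl; sym; trans; cong; cong₂; module ≡-Reasoning)
open import Relation.Nullary.Decidable using (Dec; yes; no; does; dec-true; dec-false; _×-dec_)
open import Relation.Nullary.Negation using (¬_; contradiction)
open import Relation.Unary using (Decidable)

open ≡-Reasoning

-- No set of load vectors is ever counted: the central steps are identities between sums of an
-- arbitrary function, and both sides of the formula are brought to `loadSum n q F`, the sum of `F`
-- over the vectors of n loads with total q. The obstacle is that removing a layer changes the
-- function: what remains is a sum of F (zeros ++ map suc v) over shorter vectors v. The induction
-- on layers is therefore stated for every symmetric `F`. Symmetry lets the empty buckets be moved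
-- to the front, and it survives the substitution. The actual weight is inserted only at the end; it
-- is visibly symmetric because it contains the quotient q! / ∏ᵦ vᵦ! in place of the product of
-- binomials that counts the arrangements bucket by bucket. On the other side, filtered partitions
-- have no recursion of their own. As a binomial vanishes at every increase of the parts, the filter
-- weakens to the condition on the total alone, and that condition passes to the tail of a list.

private
  variable
    A B : Set

+-interchange : ∀ a b c d → a + b + (c + d) ≡ a + c + (b + d)
+-interchange = interchange +-commutativeSemigroup

*-interchange : ∀ a b c d → a * b * (c * d) ≡ a * c * (b * d)
*-interchange = interchange *-commutativeSemigroup

-- Sums over lists

∑-cong : (xs : List A) {f g : A → ℕ} → f ≗ g → ∑ xs f ≡ ∑ xs g
∑-cong xs f≗g = cong sum (map-cong f≗g xs)

∑-cong-∈ : (xs : List A) {f g : A → ℕ} → (∀ {x} → x ∈ xs → f x ≡ g x) → ∑ xs f ≡ ∑ xs g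
∑-cong-∈ []       f≗g = refl
∑-cong-∈ (x ∷ xs) f≗g = cong₂ _+_ (f≗g (here refl)) (∑-cong-∈ xs (f≗g ∘ there))

∑-map : (h : A → B) (xs : List A) (f : B → ℕ) → ∑ (map h xs) f ≡ ∑ xs (f ∘ h)
∑-map h xs f = cong sum (sym (map-∘ xs))

∑-++ : (xs ys : List A) (f : A → ℕ) → ∑ (xs ++ ys) f ≡ ∑ xs f + ∑ ys f
∑-++ xs ys f = trans (cong sum (map-++ f xs ys)) (sum-++ (map f xs) (map f ys))

∑-zero : (xs : List A) → (∑[ x ∈ xs ] 0) ≡ 0
∑-zero []       = refl
∑-zero (x ∷ xs) = ∑-zero xs

∑-distrib-+ : (xs : List A) (f g : A → ℕ) → (∑[ x ∈ xs ] (f x + g x)) ≡ ∑ xs f + ∑ xs g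
∑-distrib-+ []       f g = refl
∑-distrib-+ (x ∷ xs) f g =
  trans (cong (f x + g x +_) (∑-distrib-+ xs f g)) (+-interchange (f x) (g x) (∑ xs f) (∑ xs g))

*-distribˡ-∑ : ∀ c (xs : List A) (f : A → ℕ) → c * ∑ xs f ≡ (∑[ x ∈ xs ] (c * f x))
*-distribˡ-∑ c []       f = *-zeroʳ c
*-distribˡ-∑ c (x ∷ xs) f =
  trans (*-distribˡ-+ c (f x) (∑ xs f)) (cong (c * f x +_) (*-distribˡ-∑ c xs f))

∑-swap : (xs : List A) (ys : List B) (f : A → B → ℕ) →
  (∑[ x ∈ xs ] ∑[ y ∈ ys ] f x y) ≡ (∑[ y ∈ ys ] ∑[ x ∈ xs ] f x y)
∑-swap []       ys f = sym (∑-zero ys)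
∑-swap (x ∷ xs) ys f = trans (cong (∑ ys (f x) +_) (∑-swap xs ys f)) (sym (∑-distrib-+ ys (f x) _))

∑-concatMap : (h : A → List B) (xs : List A) (f : B → ℕ) →
  ∑ (concatMap h xs) f ≡ (∑[ x ∈ xs ] ∑[ y ∈ h x ] f y)
∑-concatMap h []       f = refl
∑-concatMap h (x ∷ xs) f = trans (∑-++ (h x) _ f) (cong (∑ (h x) f +_) (∑-concatMap h xs f))

∑-cartesianProductWith : {C : Set} (h : A → B → C) (xs : List A) (ys : List B) (f : C → ℕ) →
  ∑ (cartesianProductWith h xs ys) f ≡ (∑[ x ∈ xs ] ∑[ y ∈ ys ] f (h x y))
∑-cartesianProductWith h []       ys f = refl
∑-cartesianProductWith h (x ∷ xs) ys f =
  trans (∑-++ (map (h x) ys) _ f) (cong₂ _+_ (∑-map (h x) ys f) (∑-cartesianProductWith h xs ys f))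

∑-applyUpTo : (g : ℕ → A) (n : ℕ) (f : A → ℕ) → ∑ (applyUpTo g n) f ≡ sum (applyUpTo (f ∘ g) n)
∑-applyUpTo g n f = cong sum (map-applyUpTo g f n)

∑-allFin-suc : ∀ n (f : Fin (suc n) → ℕ) → ∑ (allFin (suc n)) f ≡ f zero + ∑ (allFin n) (f ∘ suc)
∑-allFin-suc n f =
  cong ((f zero +_) ∘ sum) (trans (map-tabulate suc f) (sym (map-tabulate id (f ∘ suc))))

-- Turns a filter into a choice between the term and 0, so that sums under different conditions
-- compare term by term over one list. Only `does` is inspected, hence a test such as `suc _ ≟ℕ 0`
-- reduces.
restrict : {P : Set} → Dec P → ℕ → ℕ
restrict P? y = if does P? then y else 0

restrict-yes : {P : Set} (P? : Dec P) {y : ℕ} → P → restrict P? y ≡ y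
restrict-yes P? p rewrite dec-true P? p = refl

restrict-no : {P : Set} (P? : Dec P) {y : ℕ} → ¬ P → restrict P? y ≡ 0
restrict-no P? ¬p rewrite dec-false P? ¬p = refl

∑-filter : {P : A → Set} (P? : Decidable P) (xs : List A) (f : A → ℕ) →
  ∑ (filter P? xs) f ≡ (∑[ x ∈ xs ] restrict (P? x) (f x))
∑-filter P? []       f = refl
∑-filter P? (x ∷ xs) f with P? x
... | yes _ = cong (f x +_) (∑-filter P? xs f)
... | no _  = ∑-filter P? xs f

applyUpTo-cong : ∀ n {f g : ℕ → A} → f ≗ g → applyUpTo f n ≡ applyUpTo g n
applyUpTo-cong zero    f≗g = refl
applyUpTo-cong (suc n) f≗g = cong₂ _∷_ (f≗g 0) (applyUpTo-cong n (f≗g ∘ suc))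

sum-applyUpTo-zero : ∀ n (f : ℕ → ℕ) → (∀ i → f i ≡ 0) → sum (applyUpTo f n) ≡ 0
sum-applyUpTo-zero zero    f f≡0 = refl
sum-applyUpTo-zero (suc n) f f≡0 = cong₂ _+_ (f≡0 0) (sum-applyUpTo-zero n (f ∘ suc) (f≡0 ∘ suc))

sum-applyUpTo-drop : ∀ s k (f : ℕ → ℕ) → (∀ i → i < s → f i ≡ 0) →
  sum (applyUpTo f k) ≡ sum (applyUpTo (f ∘ (s +_)) (k ∸ s))
sum-applyUpTo-drop zero    k       f f≡0 = refl
sum-applyUpTo-drop (suc s) zero    f f≡0 = refl
sum-applyUpTo-drop (suc s) (suc k) f f≡0 =
  cong₂ _+_ (f≡0 0 z<s) (sum-applyUpTo-drop s k (f ∘ suc) (λ i i<s → f≡0 (suc i) (s<s i<s)))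

-- Sums over j + k = n

-- Both j and k are handed to `g`, so no `n ∸ j` appears and reindexing is structural recursion.
antidiagonalSum : ℕ → (ℕ → ℕ → ℕ) → ℕ
antidiagonalSum zero    g = g 0 0
antidiagonalSum (suc n) g = g 0 (suc n) + antidiagonalSum n (g ∘ suc)

antidiagonal-cong : ∀ n {g h : ℕ → ℕ → ℕ} → (∀ j k → j + k ≡ n → g j k ≡ h j k) →
  antidiagonalSum n g ≡ antidiagonalSum n h
antidiagonal-cong zero    g≗h = g≗h 0 0 refl
antidiagonal-cong (suc n) g≗h =
  cong₂ _+_ (g≗h 0 (suc n) refl) (antidiagonal-cong n (λ j k eq → g≗h (suc j) k (cong suc eq)))

antidiagonal-distrib-+ : ∀ n (g h : ℕ → ℕ → ℕ) →
  antidiagonalSum n (λ j k → g j k + h j k) ≡ antidiagonalSum n g + antidiagonalSum n h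
antidiagonal-distrib-+ zero    g h = refl
antidiagonal-distrib-+ (suc n) g h =
  trans (cong (g 0 (suc n) + h 0 (suc n) +_) (antidiagonal-distrib-+ n (g ∘ suc) (h ∘ suc)))
    (+-interchange (g 0 (suc n)) _ _ _)

*-distribˡ-antidiagonal : ∀ n c (g : ℕ → ℕ → ℕ) →
  c * antidiagonalSum n g ≡ antidiagonalSum n (λ j k → c * g j k)
*-distribˡ-antidiagonal zero    c g = refl
*-distribˡ-antidiagonal (suc n) c g =
  trans (*-distribˡ-+ c _ _) (cong (c * g 0 (suc n) +_) (*-distribˡ-antidiagonal n c (g ∘ suc)))

antidiagonal-zero : ∀ n → antidiagonalSum n (λ _ _ → 0) ≡ 0
antidiagonal-zero zero    = refl
antidiagonal-zero (suc n) = antidiagonal-zero n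

∑-antidiagonal : ∀ n (xs : List A) (g : A → ℕ → ℕ → ℕ) →
  (∑[ x ∈ xs ] antidiagonalSum n (g x)) ≡ antidiagonalSum n (λ j k → ∑[ x ∈ xs ] g x j k)
∑-antidiagonal n []       g = sym (antidiagonal-zero n)
∑-antidiagonal n (x ∷ xs) g =
  trans (cong (antidiagonalSum n (g x) +_) (∑-antidiagonal n xs g))
    (sym (antidiagonal-distrib-+ n (g x) _))

antidiagonal-sucʳ : ∀ n (g : ℕ → ℕ → ℕ) →
  antidiagonalSum (suc n) g ≡ antidiagonalSum n (λ j k → g j (suc k)) + g (suc n) 0
antidiagonal-sucʳ zero    g = refl
antidiagonal-sucʳ (suc n) g =
  trans (cong (g 0 (suc (suc n)) +_) (antidiagonal-sucʳ n (g ∘ suc)))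
    (sym (+-assoc (g 0 (suc (suc n))) _ _))

antidiagonal-flip : ∀ n (g : ℕ → ℕ → ℕ) → antidiagonalSum n g ≡ antidiagonalSum n (flip g)
antidiagonal-flip zero    g = refl
antidiagonal-flip (suc n) g = begin
  g 0 (suc n) + antidiagonalSum n (g ∘ suc)         ≡⟨ +-comm (g 0 (suc n)) _ ⟩
  antidiagonalSum n (g ∘ suc) + g 0 (suc n)         ≡⟨ cong (_+ g 0 (suc n)) (antidiagonal-flip n (g ∘ suc)) ⟩
  antidiagonalSum n (flip (g ∘ suc)) + g 0 (suc n)  ≡⟨ antidiagonal-sucʳ n (flip g) ⟨
  antidiagonalSum (suc n) (flip g)                  ∎

-- Both sides run over the triples i + j + k = n. The triples with i = 0 are split off, and
-- induction covers those with i ≥ 1.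
antidiagonal-assoc : ∀ n (g : ℕ → ℕ → ℕ → ℕ) →
  antidiagonalSum n (λ i m → antidiagonalSum m (g i)) ≡
  antidiagonalSum n (λ m k → antidiagonalSum m (λ i j → g i j k))
antidiagonal-assoc zero    g = refl
antidiagonal-assoc (suc n) g = begin
  (a + antidiagonalSum n (g 0 ∘ suc)) + antidiagonalSum n (λ i m → antidiagonalSum m (g (suc i)))
    ≡⟨ cong (a + antidiagonalSum n (g 0 ∘ suc) +_) (antidiagonal-assoc n (g ∘ suc)) ⟩
  (a + antidiagonalSum n (g 0 ∘ suc)) + antidiagonalSum n h
    ≡⟨ +-assoc a _ _ ⟩
  a + (antidiagonalSum n (g 0 ∘ suc) + antidiagonalSum n h)
    ≡⟨ cong (a +_) (antidiagonal-distrib-+ n (g 0 ∘ suc) h) ⟨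
  a + antidiagonalSum n (λ m k → g 0 (suc m) k + h m k)
    ∎
  where
  a = g 0 0 (suc n)
  h : ℕ → ℕ → ℕ
  h m k = antidiagonalSum m (λ i j → g (suc i) j k)

antidiagonal-swap : ∀ n (g : ℕ → ℕ → ℕ → ℕ) →
  antidiagonalSum n (λ i m → antidiagonalSum m (g i)) ≡
  antidiagonalSum n (λ j m → antidiagonalSum m (λ i k → g i j k))
antidiagonal-swap n g = begin
  antidiagonalSum n (λ i m → antidiagonalSum m (g i))
    ≡⟨ antidiagonal-assoc n g ⟩
  antidiagonalSum n (λ m k → antidiagonalSum m (λ i j → g i j k))
    ≡⟨ antidiagonal-cong n (λ m k _ → antidiagonal-flip m (λ i j → g i j k)) ⟩
  antidiagonalSum n (λ m k → antidiagonalSum m (λ j i → g i j k))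
    ≡⟨ antidiagonal-assoc n (λ j i → g i j) ⟨
  antidiagonalSum n (λ j m → antidiagonalSum m (λ i k → g i j k))
    ∎

-- Pascal's rule in the form "one distinguished element is left out or chosen". That element is the
-- first bucket (empty or not) when a layer is removed, and a new ball (outside or inside the first
-- bucket) when arrangements are grouped.
antidiagonal-pascal : ∀ m n (g : ℕ → ℕ → ℕ) →
  antidiagonalSum (suc n) (λ j k → (suc m C j) * g j k) ≡
  antidiagonalSum (suc n) (λ j k → (m C j) * g j k) + antidiagonalSum n (λ j k → (m C j) * g (suc j) k)
antidiagonal-pascal m n g = begin
  a + antidiagonalSum n (λ j k → (suc m C suc j) * g (suc j) k)
    ≡⟨ cong (a +_) (antidiagonal-cong n (λ j k _ → pascal j k)) ⟩
  a + antidiagonalSum n (λ j k → (m C suc j) * g (suc j) k + (m C j) * g (suc j) k)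
    ≡⟨ cong (a +_) (antidiagonal-distrib-+ n _ _) ⟩
  a + (antidiagonalSum n (λ j k → (m C suc j) * g (suc j) k) +
       antidiagonalSum n (λ j k → (m C j) * g (suc j) k))
    ≡⟨ +-assoc a _ _ ⟨
  a + antidiagonalSum n (λ j k → (m C suc j) * g (suc j) k) +
  antidiagonalSum n (λ j k → (m C j) * g (suc j) k)
    ∎
  where
  -- `suc m C 0` and `m C 0` both reduce to 1, so this is the j = 0 term on either side.
  a = 1 * g 0 (suc n)
  pascal : ∀ j k → (suc m C suc j) * g (suc j) k ≡ (m C suc j) * g (suc j) k + (m C j) * g (suc j) k
  pascal j k = begin
    (suc m C suc j) * g (suc j) k                        ≡⟨ cong (_* g (suc j) k) (nCk+nC[k+1]≡[n+1]C[k+1] m j) ⟨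
    ((m C j) + (m C suc j)) * g (suc j) k                ≡⟨ cong (_* g (suc j) k) (+-comm (m C j) _) ⟩
    ((m C suc j) + (m C j)) * g (suc j) k                ≡⟨ *-distribʳ-+ (g (suc j) k) (m C suc j) _ ⟩
    (m C suc j) * g (suc j) k + (m C j) * g (suc j) k    ∎

sum-applyUpTo-antidiagonal : ∀ n N (f : ℕ → ℕ) (g : ℕ → ℕ → ℕ) → n < N →
  (∀ j k → j + k ≡ n → f j ≡ g j k) → (∀ j → n < j → f j ≡ 0) →
  sum (applyUpTo f N) ≡ antidiagonalSum n g
sum-applyUpTo-antidiagonal zero    (suc N) f g _         f≡g f≡0 =
  trans (cong₂ _+_ (f≡g 0 0 refl) (sum-applyUpTo-zero N (f ∘ suc) (λ i → f≡0 (suc i) z<s)))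
    (+-identityʳ (g 0 0))
sum-applyUpTo-antidiagonal (suc n) (suc N) f g (s<s n<N) f≡g f≡0 =
  cong₂ _+_ (f≡g 0 (suc n) refl)
    (sum-applyUpTo-antidiagonal n N (f ∘ suc) (g ∘ suc) n<N
      (λ j k eq → f≡g (suc j) k (cong suc eq)) (λ j n<j → f≡0 (suc j) (s<s n<j)))

-- Sums over load vectors

loadSum : ℕ → ℕ → (List ℕ → ℕ) → ℕ
loadSum zero    zero    F = F []
loadSum zero    (suc q) F = 0
loadSum (suc n) q       F = antidiagonalSum q (λ j k → loadSum n k (F ∘ (j ∷_)))

loadSum-cong : ∀ n q {F G : List ℕ → ℕ} → (∀ v → sum v ≡ q → F v ≡ G v) →
  loadSum n q F ≡ loadSum n q G
loadSum-cong zero    zero    F≗G = F≗G [] refl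
loadSum-cong zero    (suc q) F≗G = refl
loadSum-cong (suc n) q       F≗G = antidiagonal-cong q λ j k j+k≡q →
  loadSum-cong n k λ v eq → F≗G (j ∷ v) (trans (cong (j +_) eq) j+k≡q)

*-distribˡ-loadSum : ∀ n q c (F : List ℕ → ℕ) → c * loadSum n q F ≡ loadSum n q (λ v → c * F v)
*-distribˡ-loadSum zero    zero    c F = refl
*-distribˡ-loadSum zero    (suc q) c F = *-zeroʳ c
*-distribˡ-loadSum (suc n) q       c F =
  trans (*-distribˡ-antidiagonal q c _)
    (antidiagonal-cong q (λ j k _ → *-distribˡ-loadSum n k c (F ∘ (j ∷_))))

Symmetric : (List ℕ → ℕ) → Set
Symmetric F = ∀ {v w} → v ↭ w → F v ≡ F w

-- Choose the l nonempty buckets, and take one ball out of each of them.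
loadSum-layer : ∀ m r {F : List ℕ → ℕ} → Symmetric F →
  loadSum m r F ≡
  antidiagonalSum r (λ l k → (m C l) * loadSum l k (λ v → F (replicate (m ∸ l) 0 ++ map suc v)))
loadSum-layer zero    zero    {F} F-sym = sym (*-identityˡ _)
loadSum-layer zero    (suc r) {F} F-sym = sym (antidiagonal-zero r)
loadSum-layer (suc m) r       {F} F-sym = go r
  where
  H : ℕ → ℕ → ℕ
  H l k = loadSum l k (λ v → F (replicate (suc m ∸ l) 0 ++ map suc v))

  cons-sym : ∀ j → Symmetric (F ∘ (j ∷_))
  cons-sym j = F-sym ∘ _↭_.prep j

  -- For l ≤ m the extra 0 is absorbed into `suc m ∸ l` zeros; for l > m, where the truncation would
  -- spoil this, m C l is 0.
  zero-first : ∀ l k →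
    (m C l) * loadSum l k (λ v → F (0 ∷ replicate (m ∸ l) 0 ++ map suc v)) ≡ (m C l) * H l k
  zero-first l k with l ≤? m
  ... | yes l≤m = cong ((m C l) *_) (loadSum-cong l k λ v _ →
    cong (λ a → F (replicate a 0 ++ map suc v)) (sym (+-∸-assoc 1 l≤m)))
  ... | no  l≰m rewrite k>n⇒nCk≡0 (≰⇒> l≰m) = refl

  first : ∀ r → loadSum m r (F ∘ (0 ∷_)) ≡ antidiagonalSum r (λ l k → (m C l) * H l k)
  first r = trans (loadSum-layer m r (cons-sym 0)) (antidiagonal-cong r (λ l k _ → zero-first l k))

  -- The first bucket holds `suc j` balls and so belongs to the layer. Its j remaining balls become
  -- the first entry of the reduced load vector, beside those of the l other nonempty buckets; for
  -- this, l must be chosen before j, hence the swap.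
  rest : ∀ r → antidiagonalSum r (λ j k → loadSum m k (F ∘ (suc j ∷_))) ≡
    antidiagonalSum r (λ l k → (m C l) * H (suc l) k)
  rest r = begin
    antidiagonalSum r (λ j k → loadSum m k (F ∘ (suc j ∷_)))
      ≡⟨ antidiagonal-cong r (λ j k _ → loadSum-layer m k (cons-sym (suc j))) ⟩
    antidiagonalSum r (λ j k → antidiagonalSum k (λ l k′ →
        (m C l) * loadSum l k′ (λ v → F (suc j ∷ replicate (m ∸ l) 0 ++ map suc v))))
      ≡⟨ antidiagonal-swap r _ ⟩
    antidiagonalSum r (λ l k → antidiagonalSum k (λ j k′ →
        (m C l) * loadSum l k′ (λ v → F (suc j ∷ replicate (m ∸ l) 0 ++ map suc v))))
      -- Symmetry carries `suc j` past the zeros to the other nonempty buckets.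
      ≡⟨ antidiagonal-cong r (λ l k _ → antidiagonal-cong k (λ j k′ _ →
           cong ((m C l) *_) (loadSum-cong l k′ (λ v _ →
             F-sym (↭-sym (shift (suc j) (replicate (m ∸ l) 0) _)))))) ⟩
    antidiagonalSum r (λ l k → antidiagonalSum k (λ j k′ →
        (m C l) * loadSum l k′ (λ v → F (replicate (m ∸ l) 0 ++ map suc (j ∷ v)))))
      ≡⟨ antidiagonal-cong r (λ l k _ → *-distribˡ-antidiagonal k (m C l) _) ⟨
    antidiagonalSum r (λ l k → (m C l) * H (suc l) k)
      ∎

  go : ∀ r → antidiagonalSum r (λ j k → loadSum m k (F ∘ (j ∷_))) ≡
    antidiagonalSum r (λ l k → (suc m C l) * H l k)
  go zero    = first zero
  go (suc r) = trans (cong₂ _+_ (first (suc r)) (rest r)) (sym (antidiagonal-pascal m r H))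

-- Arrangements, grouped by their load vectors

loads : ∀ {n q} → Arrangement n q → Vec.Vec ℕ n
loads f = Vec.tabulate (load f)

loads-∷ : ∀ {n q} (b : Fin n) (f : Arrangement n q) → loads (b ∷ᶠ f) ≡ Vec.updateAt (loads f) b suc
loads-∷ {n} b f = begin
  Vec.tabulate (load (b ∷ᶠ f))                                  ≡⟨ Vec.tabulate-cong pointwise ⟩
  Vec.tabulate (Vec.lookup (Vec.updateAt (loads f) b suc))      ≡⟨ Vec.tabulate∘lookup _ ⟩
  Vec.updateAt (loads f) b suc                                  ∎
  where
  pointwise : ∀ c → load (b ∷ᶠ f) c ≡ Vec.lookup (Vec.updateAt (loads f) b suc) c
  pointwise c with b ≟ c
  ... | yes refl = sym (trans (Vec.lookup∘updateAt b (loads f)) (cong suc (Vec.lookup∘tabulate (load f) b)))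
  ... | no  b≢c  = sym (trans (Vec.lookup∘updateAt′ c b (b≢c ∘ sym) (loads f))
                              (Vec.lookup∘tabulate (load f) c))

loads-[] : ∀ n (f : Arrangement n 0) → loads f ≡ Vec.replicate n 0
loads-[] zero    f = refl
-- Without balls every load reduces to 0 whatever the arrangement, so `λ ()` can replace `f`, whose
-- target has one bucket too many.
loads-[] (suc n) f = cong (0 Vec.∷_) (loads-[] n (λ ()))

arrangementSum : ∀ n q → (Vec.Vec ℕ n → ℕ) → ℕ
arrangementSum n q F = ∑[ f ∈ arrangements n q ] F (loads f)

arrangementSum-zero : ∀ n F → arrangementSum n 0 F ≡ F (Vec.replicate n 0)
arrangementSum-zero n F = trans (+-identityʳ _) (cong F (loads-[] n []ᶠ))

arrangementSum-suc : ∀ n q F →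
  arrangementSum n (suc q) F ≡ (∑[ b ∈ allFin n ] arrangementSum n q (λ v → F (Vec.updateAt v b suc)))
arrangementSum-suc n q F =
  trans (∑-cartesianProductWith _∷ᶠ_ (allFin n) (arrangements n q) (F ∘ loads))
    (∑-cong (allFin n) (λ b → ∑-cong (arrangements n q) (λ f → cong F (loads-∷ b f))))

-- Choose the balls that go to the first bucket.
arrangementSum-first : ∀ n q F →
  arrangementSum (suc n) q F ≡
  antidiagonalSum q (λ j k → (q C j) * arrangementSum n k (F ∘ (j Vec.∷_)))
arrangementSum-first n zero    F = begin
  arrangementSum (suc n) 0 F                  ≡⟨ arrangementSum-zero (suc n) F ⟩
  F (0 Vec.∷ Vec.replicate n 0)               ≡⟨ arrangementSum-zero n (F ∘ (0 Vec.∷_)) ⟨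
  arrangementSum n 0 (F ∘ (0 Vec.∷_))         ≡⟨ *-identityˡ _ ⟨
  1 * arrangementSum n 0 (F ∘ (0 Vec.∷_))     ∎
arrangementSum-first n (suc q) F = begin
  arrangementSum (suc n) (suc q) F
    ≡⟨ arrangementSum-suc (suc n) q F ⟩
  (∑[ b ∈ allFin (suc n) ] arrangementSum (suc n) q (λ v → F (Vec.updateAt v b suc)))
    ≡⟨ ∑-allFin-suc n _ ⟩
  arrangementSum (suc n) q (λ v → F (Vec.updateAt v zero suc)) +
  (∑[ b ∈ allFin n ] arrangementSum (suc n) q (λ v → F (Vec.updateAt v (suc b) suc)))
    ≡⟨ cong₂ _+_ (arrangementSum-first n q (λ v → F (Vec.updateAt v zero suc)))
         (∑-cong (allFin n) (λ b → arrangementSum-first n q (λ v → F (Vec.updateAt v (suc b) suc)))) ⟩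
  antidiagonalSum q (λ j k → (q C j) * G (suc j) k) +
  (∑[ b ∈ allFin n ] antidiagonalSum q (λ j k →
      (q C j) * arrangementSum n k (λ v → F (j Vec.∷ Vec.updateAt v b suc))))
    ≡⟨ cong (antidiagonalSum q (λ j k → (q C j) * G (suc j) k) +_) other-buckets ⟩
  antidiagonalSum q (λ j k → (q C j) * G (suc j) k) +
  antidiagonalSum (suc q) (λ j k → (q C j) * G j k)
    ≡⟨ +-comm (antidiagonalSum q (λ j k → (q C j) * G (suc j) k)) _ ⟩
  antidiagonalSum (suc q) (λ j k → (q C j) * G j k) +
  antidiagonalSum q (λ j k → (q C j) * G (suc j) k)
    ≡⟨ antidiagonal-pascal q q G ⟨
  antidiagonalSum (suc q) (λ j k → (suc q C j) * G j k)
    ∎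
  where
  G : ℕ → ℕ → ℕ
  G j k = arrangementSum n k (F ∘ (j Vec.∷_))

  -- Summing over the bucket b of the new ball gives the arrangements of `suc k` balls in the
  -- buckets other than the first.
  other-buckets :
    (∑[ b ∈ allFin n ] antidiagonalSum q (λ j k →
        (q C j) * arrangementSum n k (λ v → F (j Vec.∷ Vec.updateAt v b suc)))) ≡
    antidiagonalSum (suc q) (λ j k → (q C j) * G j k)
  other-buckets = begin
    (∑[ b ∈ allFin n ] antidiagonalSum q (λ j k →
        (q C j) * arrangementSum n k (λ v → F (j Vec.∷ Vec.updateAt v b suc))))
      ≡⟨ ∑-antidiagonal q (allFin n) _ ⟩
    antidiagonalSum q (λ j k → ∑[ b ∈ allFin n ]
        ((q C j) * arrangementSum n k (λ v → F (j Vec.∷ Vec.updateAt v b suc))))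
      ≡⟨ antidiagonal-cong q (λ j k _ → *-distribˡ-∑ (q C j) (allFin n) _) ⟨
    antidiagonalSum q (λ j k → (q C j) *
        (∑[ b ∈ allFin n ] arrangementSum n k (λ v → F (j Vec.∷ Vec.updateAt v b suc))))
      ≡⟨ antidiagonal-cong q (λ j k _ → cong ((q C j) *_) (arrangementSum-suc n k (F ∘ (j Vec.∷_)))) ⟨
    antidiagonalSum q (λ j k → (q C j) * G j (suc k))
      ≡⟨ +-identityʳ _ ⟨
    antidiagonalSum q (λ j k → (q C j) * G j (suc k)) + 0
      -- The missing end term j = `suc q` is supplied with coefficient q C `suc q` = 0.
      ≡⟨ cong (λ c → antidiagonalSum q (λ j k → (q C j) * G j (suc k)) + c * G (suc q) 0)
           (k>n⇒nCk≡0 (n<1+n q)) ⟨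
    antidiagonalSum q (λ j k → (q C j) * G j (suc k)) + (q C suc q) * G (suc q) 0
      ≡⟨ antidiagonal-sucʳ q (λ j k → (q C j) * G j k) ⟨
    antidiagonalSum (suc q) (λ j k → (q C j) * G j k)
      ∎

-- Each bucket in turn chooses its balls among those left over, as in `arrangementSum-first`.
multinomial : List ℕ → ℕ
multinomial []      = 1
multinomial (j ∷ v) = ((j + sum v) C j) * multinomial v

∏! : List ℕ → ℕ
∏! v = product (map _! v)

∏!≢0 : ∀ v → NonZero (∏! v)
∏!≢0 []      = _
∏!≢0 (j ∷ v) = m*n≢0 (j !) (∏! v) {{j !≢0}} {{∏!≢0 v}}

[j+k]Cj*[j!*k!]≡[j+k]! : ∀ j k → ((j + k) C j) * (j ! * k !) ≡ (j + k) !
[j+k]Cj*[j!*k!]≡[j+k]! j k = begin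
  ((j + k) C j) * (j ! * k !)
    ≡⟨ cong (λ i → ((j + k) C j) * (j ! * i !)) (m+n∸m≡n j k) ⟨
  ((j + k) C j) * (j ! * (j + k ∸ j) !)
    ≡⟨ cong (_* (j ! * (j + k ∸ j) !)) (nCk≡n!/k![n-k]! (m≤m+n j k)) ⟩
  ((j + k) ! / (j ! * (j + k ∸ j) !)) * (j ! * (j + k ∸ j) !)
    ≡⟨ m/n*n≡m (k![n∸k]!∣n! (m≤m+n j k)) ⟩
  (j + k) !
    ∎
  where instance _ = j !* (j + k ∸ j) !≢0

multinomial*∏! : ∀ v → multinomial v * ∏! v ≡ sum v !
multinomial*∏! []      = refl
multinomial*∏! (j ∷ v) = begin
  b * multinomial v * (j ! * ∏! v)    ≡⟨ lemma b (multinomial v) (j !) (∏! v) ⟩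
  b * (j ! * (multinomial v * ∏! v))  ≡⟨ cong (λ x → b * (j ! * x)) (multinomial*∏! v) ⟩
  b * (j ! * sum v !)                 ≡⟨ [j+k]Cj*[j!*k!]≡[j+k]! j (sum v) ⟩
  (j + sum v) !                       ∎
  where
  b = (j + sum v) C j
  lemma : ∀ a b c d → a * b * (c * d) ≡ a * (c * (b * d))
  lemma = solve-∀

multinomial≡/ : ∀ v → multinomial v ≡ (_/_ (sum v !) (∏! v) {{∏!≢0 v}})
multinomial≡/ v =
  trans (sym (m*n/n≡m (multinomial v) (∏! v))) (/-congˡ (multinomial*∏! v))
  where instance _ = ∏!≢0 v

arrangementSum≡loadSum : ∀ n q (F : List ℕ → ℕ) →
  arrangementSum n q (F ∘ Vec.toList) ≡ loadSum n q (λ v → multinomial v * F v)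
arrangementSum≡loadSum zero    zero    F = refl
arrangementSum≡loadSum zero    (suc q) F = refl
arrangementSum≡loadSum (suc n) q       F =
  trans (arrangementSum-first n q (F ∘ Vec.toList)) (antidiagonal-cong q step)
  where
  step : ∀ j k → j + k ≡ q →
    (q C j) * arrangementSum n k (F ∘ (j ∷_) ∘ Vec.toList) ≡
    loadSum n k (λ v → multinomial (j ∷ v) * F (j ∷ v))
  step j k j+k≡q = begin
    (q C j) * arrangementSum n k (F ∘ (j ∷_) ∘ Vec.toList)
      ≡⟨ cong ((q C j) *_) (arrangementSum≡loadSum n k (F ∘ (j ∷_))) ⟩
    (q C j) * loadSum n k (λ v → multinomial v * F (j ∷ v))
      ≡⟨ *-distribˡ-loadSum n k (q C j) _ ⟩
    loadSum n k (λ v → (q C j) * (multinomial v * F (j ∷ v)))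
      -- `multinomial` reads the number of balls off the vector; it is q because only vectors of
      -- total k occur here and j + k = q.
      ≡⟨ loadSum-cong n k (λ v sum≡k → trans (sym (*-assoc (q C j) _ _))
           (cong (λ p → (p C j) * multinomial v * F (j ∷ v))
             (sym (trans (cong (j +_) sum≡k) j+k≡q)))) ⟩
    loadSum n k (λ v → multinomial (j ∷ v) * F (j ∷ v))
      ∎

collisionCount : ℕ → List ℕ → ℕ
collisionCount s v = ∑[ r ∈ v ] (r C s)

-- For v of total q: the number of arrangements with loads v, times the collisions of each. Keeping
-- q as a parameter leaves only `∏!` and `collisionCount` to be checked for symmetry.
weight : ℕ → ℕ → List ℕ → ℕ
weight q s v = (_/_ (q !) (∏! v) {{∏!≢0 v}}) * collisionCount s v

weight-symmetric : ∀ q s → Symmetric (weight q s)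
weight-symmetric q s {v} {w} v↭w =
  cong₂ _*_ (/-congʳ {{∏!≢0 v}} {{∏!≢0 w}} (product-↭ (map⁺ _! v↭w))) (sum-↭ (map⁺ (_C s) v↭w))

collisions≡collisionCount : ∀ {n q} s (f : Arrangement n q) →
  collisions s f ≡ collisionCount s (Vec.toList (loads f))
collisions≡collisionCount {n} s f = go n (load f)
  where
  go : ∀ n (g : Fin n → ℕ) →
    (∑[ b ∈ allFin n ] (g b C s)) ≡ collisionCount s (Vec.toList (Vec.tabulate g))
  go zero    g = refl
  go (suc n) g = trans (∑-allFin-suc n _) (cong ((g zero C s) +_) (go n (g ∘ suc)))

C-B≡loadSum : ∀ n q s → C-B n q s ≡ loadSum n q (weight q s)
C-B≡loadSum n q s = begin
  C-B n q s
    ≡⟨ ∑-cong (arrangements n q) (collisions≡collisionCount s) ⟩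
  arrangementSum n q (collisionCount s ∘ Vec.toList)
    ≡⟨ arrangementSum≡loadSum n q (collisionCount s) ⟩
  loadSum n q (λ v → multinomial v * collisionCount s v)
    ≡⟨ loadSum-cong n q (λ v sum≡q → cong (_* collisionCount s v)
         (trans (multinomial≡/ v) (/-congˡ {{∏!≢0 v}} (cong _! sum≡q)))) ⟩
  loadSum n q (weight q s)
    ∎

-- Lists with at most K entries from 1 to Q

-- The bounds are separate because removing the first entry lowers K but not Q; `partitions q`
-- filters the case Q = K = q.
listsUpTo : ℕ → ℕ → List (List ℕ)
listsUpTo Q K = concatMap (λ k → listsOfLength k ⟦ 1 ⋯ Q ⟧) ⟦ 0 ⋯ K ⟧

∑-listsUpTo : ∀ Q K (f : List ℕ → ℕ) →
  ∑ (listsUpTo Q K) f ≡ sum (applyUpTo (λ k → ∑ (listsOfLength k ⟦ 1 ⋯ Q ⟧) f) (suc K))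
∑-listsUpTo Q K f =
  trans (∑-concatMap (λ k → listsOfLength k ⟦ 1 ⋯ Q ⟧) ⟦ 0 ⋯ K ⟧ f) (∑-applyUpTo (0 +_) (suc K) _)

∑-listsUpTo-zero : ∀ Q f → ∑ (listsUpTo Q 0) f ≡ f []
∑-listsUpTo-zero Q f = +-identityʳ (f [])

∑-listsUpTo-suc : ∀ Q K (f : List ℕ → ℕ) →
  ∑ (listsUpTo Q (suc K)) f ≡ f [] + (∑[ x ∈ ⟦ 1 ⋯ Q ⟧ ] ∑ (listsUpTo Q K) (f ∘ (x ∷_)))
∑-listsUpTo-suc Q K f = begin
  ∑ (listsUpTo Q (suc K)) f
    ≡⟨ ∑-listsUpTo Q (suc K) f ⟩
  (f [] + 0) + sum (applyUpTo (λ k → ∑ (listsOfLength (suc k) ⟦ 1 ⋯ Q ⟧) f) (suc K))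
    ≡⟨ cong₂ _+_ (+-identityʳ (f [])) (cong sum (applyUpTo-cong (suc K) λ k →
         ∑-cartesianProductWith _∷_ ⟦ 1 ⋯ Q ⟧ (listsOfLength k ⟦ 1 ⋯ Q ⟧) f)) ⟩
  f [] + sum (applyUpTo (λ k → ∑[ x ∈ ⟦ 1 ⋯ Q ⟧ ] S x k) (suc K))
    ≡⟨ cong (f [] +_) (∑-applyUpTo (0 +_) (suc K) _) ⟨
  f [] + (∑[ k ∈ ⟦ 0 ⋯ K ⟧ ] ∑[ x ∈ ⟦ 1 ⋯ Q ⟧ ] S x k)
    ≡⟨ cong (f [] +_) (∑-swap ⟦ 0 ⋯ K ⟧ ⟦ 1 ⋯ Q ⟧ (flip S)) ⟩
  f [] + (∑[ x ∈ ⟦ 1 ⋯ Q ⟧ ] ∑[ k ∈ ⟦ 0 ⋯ K ⟧ ] S x k)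
    ≡⟨ cong (f [] +_) (∑-cong ⟦ 1 ⋯ Q ⟧ λ x →
         ∑-concatMap (λ k → listsOfLength k ⟦ 1 ⋯ Q ⟧) ⟦ 0 ⋯ K ⟧ (f ∘ (x ∷_))) ⟨
  f [] + (∑[ x ∈ ⟦ 1 ⋯ Q ⟧ ] ∑ (listsUpTo Q K) (f ∘ (x ∷_)))
    ∎
  where
  S : ℕ → ℕ → ℕ
  S x k = ∑ (listsOfLength k ⟦ 1 ⋯ Q ⟧) (f ∘ (x ∷_))

-- Positivity has to come from the enumeration: since m C 0 = 1, a zero part does not make
-- `chainWeight` vanish.
listsUpTo-positive : ∀ Q K {xs} → xs ∈ listsUpTo Q K → All (_≥ 1) xs
listsUpTo-positive Q K xs∈
  with k , _ , xs∈′ ← find (∈-concatMap⁻ (λ k → listsOfLength k ⟦ 1 ⋯ Q ⟧) {xs = ⟦ 0 ⋯ K ⟧} xs∈) =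
  listsOfLength-positive k xs∈′
  where
  listsOfLength-positive : ∀ k {xs} → xs ∈ listsOfLength k ⟦ 1 ⋯ Q ⟧ → All (_≥ 1) xs
  listsOfLength-positive zero    (here refl) = []
  listsOfLength-positive (suc k) xs∈
    with x , ys , x∈ , ys∈ , refl ← ∈-cartesianProductWith⁻ _∷_ ⟦ 1 ⋯ Q ⟧ _ xs∈
    with _ , _ , refl ← ∈-applyUpTo⁻ (1 +_) x∈ = s≤s z≤n ∷ listsOfLength-positive k ys∈

-- Iterated layers

-- The number of chains of nested subsets of an m-element set with sizes x₁, x₂, ....
chainWeight : ℕ → List ℕ → ℕ
chainWeight m []       = 1
chainWeight m (x ∷ xs) = (m C x) * chainWeight x xs

-- m numbers of which xᵢ are at least i, in increasing order: a load vector with layers xs.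
conjugate : ℕ → List ℕ → List ℕ
conjugate m []       = replicate m 0
conjugate m (x ∷ xs) = replicate (m ∸ x) 0 ++ map suc (conjugate x xs)

-- The first entry is the size of the first layer, and the tail lists the layers of what remains,
-- summed with a new symmetric function. A positive entry uses up at least one ball, so r ≤ K leaves
-- room for all layers, and r ≤ Q for every possible entry.
loadSum-partitions : ∀ Q K m r {F : List ℕ → ℕ} → r ≤ K → r ≤ Q → Symmetric F →
  (∑[ xs ∈ listsUpTo Q K ] restrict (sum xs ≟ℕ r) (chainWeight m xs * F (conjugate m xs))) ≡
  loadSum m r F
loadSum-partitions Q K m zero {F} _ _ F-sym = trans (only-[] K) (sym (loadSum-zero m F))
  where
  f : List ℕ → ℕ
  f xs = restrict (sum xs ≟ℕ 0) (chainWeight m xs * F (conjugate m xs))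

  loadSum-zero : ∀ m (F : List ℕ → ℕ) → loadSum m 0 F ≡ F (replicate m 0)
  loadSum-zero zero    F = refl
  loadSum-zero (suc m) F = loadSum-zero m (F ∘ (0 ∷_))

  only-[] : ∀ K → ∑ (listsUpTo Q K) f ≡ F (replicate m 0)
  only-[] zero    = trans (∑-listsUpTo-zero Q f) (*-identityˡ _)
  only-[] (suc K) = trans (∑-listsUpTo-suc Q K f)
    (trans (cong₂ _+_ (*-identityˡ (F (replicate m 0)))
        (trans (∑-applyUpTo (1 +_) Q (λ x → ∑ (listsUpTo Q K) (f ∘ (x ∷_))))
          -- A list with first entry `suc x` fails the test for total 0 by computation.
          (sum-applyUpTo-zero Q _ (λ x → ∑-zero (listsUpTo Q K)))))
      (+-identityʳ _))
loadSum-partitions Q (suc K) m (suc r) {F} (s≤s r≤K) r<Q F-sym = begin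
  ∑ (listsUpTo Q (suc K)) f
    -- `f []` reduces to 0, as the total `suc r` is positive.
    ≡⟨ ∑-listsUpTo-suc Q K f ⟩
  (∑[ x ∈ ⟦ 1 ⋯ Q ⟧ ] ∑ (listsUpTo Q K) (f ∘ (x ∷_)))
    ≡⟨ ∑-applyUpTo (1 +_) Q (λ x → ∑ (listsUpTo Q K) (f ∘ (x ∷_))) ⟩
  sum (applyUpTo (λ x → ∑ (listsUpTo Q K) (f ∘ (suc x ∷_))) Q)
    ≡⟨ sum-applyUpTo-antidiagonal r Q _ (h ∘ suc) r<Q first-part too-large ⟩
  antidiagonalSum r (h ∘ suc)
    -- The added term `h 0 (suc r)` reduces to 0: an empty layer leaves no bucket for the `suc r`
    -- balls.
    ≡⟨⟩
  antidiagonalSum (suc r) h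
    ≡⟨ loadSum-layer m (suc r) F-sym ⟨
  loadSum m (suc r) F
    ∎
  where
  f : List ℕ → ℕ
  f xs = restrict (sum xs ≟ℕ suc r) (chainWeight m xs * F (conjugate m xs))

  F′ : ℕ → List ℕ → ℕ
  F′ l v = F (replicate (m ∸ l) 0 ++ map suc v)

  F′-sym : ∀ l → Symmetric (F′ l)
  F′-sym l v↭w = F-sym (++⁺ˡ (replicate (m ∸ l) 0) (map⁺ suc v↭w))

  h : ℕ → ℕ → ℕ
  h l k = (m C l) * loadSum l k (F′ l)

  first-part : ∀ x k → x + k ≡ r → ∑ (listsUpTo Q K) (f ∘ (suc x ∷_)) ≡ h (suc x) k
  first-part x k refl = begin
    ∑ (listsUpTo Q K) (f ∘ (suc x ∷_))
      ≡⟨ ∑-cong (listsUpTo Q K) pull-out ⟩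
    (∑[ xs ∈ listsUpTo Q K ] ((m C suc x) * t xs))
      ≡⟨ *-distribˡ-∑ (m C suc x) (listsUpTo Q K) _ ⟨
    (m C suc x) * ∑ (listsUpTo Q K) t
      ≡⟨ cong ((m C suc x) *_) (loadSum-partitions Q K (suc x) k
           (≤-trans (m≤n+m k x) r≤K) (≤-trans (m≤n+m k (suc x)) r<Q) (F′-sym (suc x))) ⟩
    h (suc x) k
      ∎
    where
    t : List ℕ → ℕ
    t xs = restrict (sum xs ≟ℕ k) (chainWeight (suc x) xs * F′ (suc x) (conjugate (suc x) xs))

    pull-out : ∀ xs → f (suc x ∷ xs) ≡ (m C suc x) * t xs
    pull-out xs with sum xs ≟ℕ k
    ... | yes sum≡k =
      trans (restrict-yes (sum (suc x ∷ xs) ≟ℕ suc (x + k)) (cong (suc x +_) sum≡k))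
        (trans (*-assoc (m C suc x) _ _)
          (cong ((m C suc x) *_) (sym (restrict-yes (sum xs ≟ℕ k) sum≡k))))
    ... | no  sum≢k =
      trans (restrict-no (sum (suc x ∷ xs) ≟ℕ suc (x + k)) (sum≢k ∘ +-cancelˡ-≡ (suc x) (sum xs) k))
        (sym (trans (cong ((m C suc x) *_) (restrict-no (sum xs ≟ℕ k) sum≢k)) (*-zeroʳ (m C suc x))))

  too-large : ∀ x → r < x → ∑ (listsUpTo Q K) (f ∘ (suc x ∷_)) ≡ 0
  too-large x r<x = trans
    (∑-cong (listsUpTo Q K) (λ xs → restrict-no (sum (suc x ∷ xs) ≟ℕ suc r)
      (λ eq → <⇒≢ (≤-trans (s<s r<x) (m≤m+n (suc x) (sum xs))) (sym eq))))
    (∑-zero (listsUpTo Q K))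

-- Evaluation of the summands

∏-binomials≡chainWeight : ∀ x xs →
  (∏[ i ∈ ⟦ 2 ⋯ length (x ∷ xs) ⟧ ] (part (x ∷ xs) (i ∸ 1) C part (x ∷ xs) i)) ≡ chainWeight x xs
∏-binomials≡chainWeight x xs =
  trans (cong product (map-applyUpTo (2 +_) _ (length xs))) (go x xs)
  where
  go : ∀ x xs →
    product (applyUpTo (λ i → part (x ∷ xs) (suc i) C part (x ∷ xs) (suc (suc i))) (length xs)) ≡
    chainWeight x xs
  go x []       = refl
  go x (y ∷ ys) = cong ((x C y) *_) (go y ys)

-- Wherever an entry exceeds its predecessor, the binomial there is 0.
chainWeight-unlinked : ∀ m xs → ¬ Linked _≥_ (m ∷ xs) → chainWeight m xs ≡ 0
chainWeight-unlinked m []       ¬linked = contradiction [-] ¬linked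
chainWeight-unlinked m (x ∷ xs) ¬linked with x ≤? m
... | yes x≤m = trans (cong ((m C x) *_) (chainWeight-unlinked x xs (¬linked ∘ (x≤m ∷_)))) (*-zeroʳ (m C x))
... | no  x≰m = cong (_* chainWeight x xs) (k>n⇒nCk≡0 (≰⇒> x≰m))

∏-replicate : ∀ m a → product (replicate m a) ≡ a ^ m
∏-replicate zero    a = refl
∏-replicate (suc m) a = cong (a *_) (∏-replicate m a)

∑-replicate : ∀ m a → sum (replicate m a) ≡ m * a
∑-replicate zero    a = refl
∑-replicate (suc m) a = cong (a +_) (∑-replicate m a)

^-distribʳ-* : ∀ n a b → (a * b) ^ n ≡ a ^ n * b ^ n
^-distribʳ-* zero    a b = refl
^-distribʳ-* (suc n) a b = trans (cong (a * b *_) (^-distribʳ-* n a b)) (*-interchange a b (a ^ n) (b ^ n))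

-- Taking out i! for each of the m buckets leaves one factor i + j for each ball in layer j.
∏!-conjugate : ∀ i m xs → Linked _≥_ (m ∷ xs) →
  (∏[ r ∈ conjugate m xs ] ((i + r) !)) ≡
  (i !) ^ m * product (applyUpTo (λ j → (i + suc j) ^ part xs (suc j)) (length xs))
∏!-conjugate i m []       _ = begin
  product (map (λ r → (i + r) !) (replicate m 0))  ≡⟨ cong product (map-replicate _ m 0) ⟩
  product (replicate m ((i + 0) !))                ≡⟨ ∏-replicate m _ ⟩
  ((i + 0) !) ^ m                                    ≡⟨ cong (λ z → (z !) ^ m) (+-identityʳ i) ⟩
  (i !) ^ m                                          ≡⟨ *-identityʳ _ ⟨
  (i !) ^ m * 1                                      ∎
∏!-conjugate i m (x ∷ xs) (x≤m ∷ linked) = begin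
  product (map level (replicate (m ∸ x) 0 ++ map suc (conjugate x xs)))
    ≡⟨ cong product (map-++ _ (replicate (m ∸ x) 0) _) ⟩
  product (map level (replicate (m ∸ x) 0) ++ map level (map suc (conjugate x xs)))
    ≡⟨ product-++ (map level (replicate (m ∸ x) 0)) _ ⟩
  product (map level (replicate (m ∸ x) 0)) * product (map level (map suc (conjugate x xs)))
    ≡⟨ cong₂ _*_ zeros (cong product (sym (map-∘ (conjugate x xs)))) ⟩
  (i !) ^ (m ∸ x) * product (map (λ r → (i + suc r) !) (conjugate x xs))
    ≡⟨ cong (λ p → (i !) ^ (m ∸ x) * product p) (map-cong (λ r → cong _! (+-suc i r)) (conjugate x xs)) ⟩
  (i !) ^ (m ∸ x) * product (map (λ r → (suc i + r) !) (conjugate x xs))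
    ≡⟨ cong ((i !) ^ (m ∸ x) *_) (∏!-conjugate (suc i) x xs linked) ⟩
  (i !) ^ (m ∸ x) * ((suc i !) ^ x * layers)
    ≡⟨ cong (λ p → (i !) ^ (m ∸ x) * (p * _)) (^-distribʳ-* x (suc i) (i !)) ⟩
  (i !) ^ (m ∸ x) * (suc i ^ x * (i !) ^ x * layers)
    ≡⟨ lemma ((i !) ^ (m ∸ x)) (suc i ^ x) ((i !) ^ x) _ ⟩
  (i !) ^ (m ∸ x) * (i !) ^ x * (suc i ^ x * layers)
    ≡⟨ cong₂ _*_ (trans (sym (^-distribˡ-+-* (i !) (m ∸ x) x)) (cong ((i !) ^_) (m∸n+n≡m x≤m)))
         (cong₂ _*_ (cong (_^ x) (sym (+-comm i 1)))
           (cong product (applyUpTo-cong (length xs) λ j →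
             cong (_^ part xs (suc j)) (sym (+-suc i (suc j)))))) ⟩
  (i !) ^ m * product (applyUpTo (λ j → (i + suc j) ^ part (x ∷ xs) (suc j)) (length (x ∷ xs)))
    ∎
  where
  level : ℕ → ℕ
  level r = (i + r) !
  layers = product (applyUpTo (λ j → (suc i + suc j) ^ part xs (suc j)) (length xs))
  lemma : ∀ a b c d → a * (b * c * d) ≡ a * c * (b * d)
  lemma = solve-∀
  zeros : product (map level (replicate (m ∸ x) 0)) ≡ (i !) ^ (m ∸ x)
  zeros = trans (cong product (map-replicate _ (m ∸ x) 0))
    (trans (∏-replicate (m ∸ x) _) (cong (λ z → (z !) ^ (m ∸ x)) (+-identityʳ i)))

denominator≡∏! : ∀ m xs → Linked _≥_ (m ∷ xs) → denominator xs ≡ ∏! (conjugate m xs)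
denominator≡∏! m xs linked = sym (begin
  ∏! (conjugate m xs)                          ≡⟨ ∏!-conjugate 0 m xs linked ⟩
  1 ^ m * layers                               ≡⟨ cong (_* layers) (^-zeroˡ m) ⟩
  1 * layers                                   ≡⟨ *-identityˡ layers ⟩
  layers                                       ≡⟨ cong product (map-applyUpTo (1 +_) _ (length xs)) ⟨
  denominator xs                               ∎)
  where layers = product (applyUpTo (λ j → suc j ^ part xs (suc j)) (length xs))

-- Removing a layer replaces `c` by `c ∘ suc`, hence the arbitrary `c`. The last layer stands apart:
-- its λₖ buckets have load exactly k, with no further part to subtract.
∑-conjugate : ∀ (c : ℕ → ℕ) m x xs → let k = length (x ∷ xs) in
  ∑ (conjugate m (x ∷ xs)) c ≡
  (m ∸ x) * c 0 + (part (x ∷ xs) k * c k +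
    sum (applyUpTo (λ i → (part (x ∷ xs) (suc i) ∸ part (x ∷ xs) (suc (suc i))) * c (suc i)) (k ∸ 1)))
∑-conjugate c m x xs = begin
  ∑ (replicate (m ∸ x) 0 ++ map suc (conjugate x xs)) c
    ≡⟨ ∑-++ (replicate (m ∸ x) 0) _ c ⟩
  ∑ (replicate (m ∸ x) 0) c + ∑ (map suc (conjugate x xs)) c
    ≡⟨ cong₂ _+_ (∑-const (m ∸ x) c) (trans (∑-map suc (conjugate x xs) c) (go c x xs)) ⟩
  (m ∸ x) * c 0 + _
    ∎
  where
  ∑-const : ∀ m (c : ℕ → ℕ) → ∑ (replicate m 0) c ≡ m * c 0
  ∑-const m c = trans (cong sum (map-replicate c m 0)) (∑-replicate m (c 0))

  go : ∀ c x xs → let k = length (x ∷ xs) in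
    ∑ (conjugate x xs) (c ∘ suc) ≡
    part (x ∷ xs) k * c k +
    sum (applyUpTo (λ i → (part (x ∷ xs) (suc i) ∸ part (x ∷ xs) (suc (suc i))) * c (suc i)) (k ∸ 1))
  go c x []       = trans (∑-const x (c ∘ suc)) (sym (+-identityʳ _))
  -- The x ∸ y zeros of `conjugate x (y ∷ ys)` become loads 1 and give the first term of the sum.
  go c x (y ∷ ys) = trans (∑-conjugate (c ∘ suc) x y ys)
    (lemma ((x ∸ y) * c 1) (part (y ∷ ys) (length (y ∷ ys)) * c (length (x ∷ y ∷ ys))) _)
    where
    lemma : ∀ a b c → a + (b + c) ≡ b + (a + c)
    lemma = solve-∀

collisionFactor : ℕ → List ℕ → ℕ
collisionFactor s xs =
  part xs k * (k C s) + (∑[ i ∈ ⟦ s ⋯ k ∸ 1 ⟧ ] ((part xs i ∸ part xs (i + 1)) * (i C s)))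
  where k = length xs

collisionFactor≡collisionCount : ∀ s m x xs → s ≥ 1 →
  collisionFactor s (x ∷ xs) ≡ collisionCount s (conjugate m (x ∷ xs))
collisionFactor≡collisionCount s m x xs s≥1 = begin
  part (x ∷ xs) k * (k C s) +
  (∑[ i ∈ ⟦ s ⋯ length xs ⟧ ] ((part (x ∷ xs) i ∸ part (x ∷ xs) (i + 1)) * (i C s)))
    ≡⟨ cong (part (x ∷ xs) k * (k C s) +_) from-s ⟩
  part (x ∷ xs) k * (k C s) + sum (applyUpTo (f ∘ suc) (length xs))
    -- Empty buckets contribute 0 C s, which is 0 because s ≥ 1.
    ≡⟨ cong (_+ (part (x ∷ xs) k * (k C s) + sum (applyUpTo (f ∘ suc) (length xs))))
         (trans (cong ((m ∸ x) *_) (k>n⇒nCk≡0 s≥1)) (*-zeroʳ (m ∸ x))) ⟨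
  (m ∸ x) * (0 C s) + (part (x ∷ xs) k * (k C s) + sum (applyUpTo (f ∘ suc) (length xs)))
    ≡⟨ ∑-conjugate (_C s) m x xs ⟨
  collisionCount s (conjugate m (x ∷ xs))
    ∎
  where
  k = length (x ∷ xs)
  f : ℕ → ℕ
  f i = (part (x ∷ xs) i ∸ part (x ∷ xs) (suc i)) * (i C s)

  f-zero : ∀ i → i < s → f i ≡ 0
  f-zero i i<s = trans (cong (d *_) (k>n⇒nCk≡0 i<s)) (*-zeroʳ d)
    where d = part (x ∷ xs) i ∸ part (x ∷ xs) (suc i)

  from-s : (∑[ i ∈ ⟦ s ⋯ length xs ⟧ ] ((part (x ∷ xs) i ∸ part (x ∷ xs) (i + 1)) * (i C s))) ≡
    sum (applyUpTo (f ∘ suc) (length xs))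
  from-s = begin
    (∑[ i ∈ ⟦ s ⋯ length xs ⟧ ] ((part (x ∷ xs) i ∸ part (x ∷ xs) (i + 1)) * (i C s)))
      ≡⟨ ∑-cong ⟦ s ⋯ length xs ⟧ (λ i →
           cong (λ j → (part (x ∷ xs) i ∸ part (x ∷ xs) j) * (i C s)) (+-comm i 1)) ⟩
    (∑[ i ∈ ⟦ s ⋯ length xs ⟧ ] f i)
      ≡⟨ ∑-applyUpTo (s +_) (k ∸ s) f ⟩
    -- Since i C s = 0 for i < s, the range extends down to 0; the term i = 0, where `part` gives
    -- its filler value, is then discarded for the same reason.
    sum (applyUpTo (f ∘ (s +_)) (k ∸ s))
      ≡⟨ sum-applyUpTo-drop s k f f-zero ⟨
    f 0 + sum (applyUpTo (f ∘ suc) (length xs))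
      ≡⟨ cong (_+ sum (applyUpTo (f ∘ suc) (length xs))) (f-zero 0 s≥1) ⟩
    sum (applyUpTo (f ∘ suc) (length xs))
      ∎

-- With fewer than s layers no bucket holds s balls: k C s is 0 and the range from s to k ∸ 1 is
-- empty.
collisionFactor-short : ∀ s xs → length xs < s → collisionFactor s xs ≡ 0
collisionFactor-short s xs k<s = cong₂ _+_
  (trans (cong (part xs (length xs) *_) (k>n⇒nCk≡0 k<s)) (*-zeroʳ (part xs (length xs))))
  (cong (λ l → ∑ (applyUpTo (s +_) l) (λ i → (part xs i ∸ part xs (i + 1)) * (i C s)))
    (m≤n⇒m∸n≡0 (≤-trans (s≤s pred[n]≤n) k<s)))

summand≡ : ∀ n q s x xs → s ≥ 1 → Linked _≥_ (n ∷ x ∷ xs) →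
  summand n q s (x ∷ xs) ≡ chainWeight n (x ∷ xs) * weight q s (conjugate n (x ∷ xs))
summand≡ n q s x xs s≥1 linked = begin
  (n C x) * P * S * (_/_ (q !) D {{denominator≢0 (x ∷ xs)}})
    ≡⟨ *-assoc ((n C x) * P) S _ ⟩
  (n C x) * P * (S * (_/_ (q !) D {{denominator≢0 (x ∷ xs)}}))
    ≡⟨ cong ((n C x) * P *_) (*-comm S _) ⟩
  (n C x) * P * ((_/_ (q !) D {{denominator≢0 (x ∷ xs)}}) * S)
    ≡⟨ cong₂ _*_ (cong ((n C x) *_) (∏-binomials≡chainWeight x xs))
         (cong₂ _*_ (/-congʳ {{denominator≢0 (x ∷ xs)}} {{∏!≢0 v}} (denominator≡∏! n (x ∷ xs) linked))
           (collisionFactor≡collisionCount s n x xs s≥1)) ⟩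
  chainWeight n (x ∷ xs) * weight q s v
    ∎
  where
  v = conjugate n (x ∷ xs)
  D = denominator (x ∷ xs)
  S = collisionFactor s (x ∷ xs)
  P = ∏[ i ∈ ⟦ 2 ⋯ length (x ∷ xs) ⟧ ] (part (x ∷ xs) (i ∸ 1) C part (x ∷ xs) i)

-- The conditions λ₁ ≤ n, λᵢ₋₁ ≥ λᵢ and k ≥ s may be dropped: without them the summand vanishes.
restrict-admissible : ∀ n q s xs → q ≥ 1 → s ≥ 1 → All (_≥ 1) xs →
  restrict (isPartition? q xs) (restrict ((part xs 1 ≤? n) ×-dec (length xs ≥? s)) (summand n q s xs)) ≡
  restrict (sum xs ≟ℕ q) (chainWeight n xs * weight q s (conjugate n xs))
-- Here q ≥ 1 excludes the empty partition: its total 0 fails both tests by computation.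
restrict-admissible n (suc q) s []       q≥1 s≥1 positive = refl
restrict-admissible n q       s (x ∷ xs) q≥1 s≥1 positive
  -- Prefixing n as λ₀ merges λ₁ ≤ n with the decrease of the parts.
  with sum (x ∷ xs) ≟ℕ q | linked? _≥?_ (n ∷ x ∷ xs)
... | no sum≢q  | _ = trans (restrict-no (isPartition? q (x ∷ xs)) (sum≢q ∘ IsPartition.sum≡))
                        (sym (restrict-no (sum (x ∷ xs) ≟ℕ q) sum≢q))
... | yes sum≡q | no ¬linked = begin
  _  ≡⟨ restrict-restrict-no (isPartition? q (x ∷ xs)) ((x ≤? n) ×-dec (length (x ∷ xs) ≥? s))
          (λ isP (x≤n , _) → ¬linked (x≤n ∷ IsPartition.decreasing isP)) ⟩
  0  ≡⟨ cong (_* weight q s (conjugate n (x ∷ xs))) (chainWeight-unlinked n (x ∷ xs) ¬linked) ⟨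
  _  ≡⟨ restrict-yes (sum (x ∷ xs) ≟ℕ q) sum≡q ⟨
  _  ∎
  where
  restrict-restrict-no : {P R : Set} (P? : Dec P) (R? : Dec R) {y : ℕ} → (P → R → ⊥) →
    restrict P? (restrict R? y) ≡ 0
  restrict-restrict-no (yes p) R? ¬pr = restrict-no R? (¬pr p)
  restrict-restrict-no (no _)  R? ¬pr = refl
... | yes sum≡q | yes linked@(x≤n ∷ decreasing) = begin
  _  ≡⟨ restrict-yes (isPartition? q (x ∷ xs)) (isPartition decreasing positive sum≡q) ⟩
  _  ≡⟨ short (length (x ∷ xs) ≥? s) ⟩
  _  ≡⟨ summand≡ n q s x xs s≥1 linked ⟩
  _  ≡⟨ restrict-yes (sum (x ∷ xs) ≟ℕ q) sum≡q ⟨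
  _  ∎
  where
  short : Dec (length (x ∷ xs) ≥ s) →
    restrict ((x ≤? n) ×-dec (length (x ∷ xs) ≥? s)) (summand n q s (x ∷ xs)) ≡ summand n q s (x ∷ xs)
  short (yes k≥s) = restrict-yes ((x ≤? n) ×-dec (length (x ∷ xs) ≥? s)) (x≤n , k≥s)
  short (no  k≱s) = trans (restrict-no ((x ≤? n) ×-dec (length (x ∷ xs) ≥? s)) (k≱s ∘ proj₂))
    (sym (trans
      (cong (λ S → a * S * b) (collisionFactor-short s (x ∷ xs) (≰⇒> k≱s)))
      (cong (_* b) (*-zeroʳ a))))
    where
    a = (n C x) * (∏[ i ∈ ⟦ 2 ⋯ length (x ∷ xs) ⟧ ] (part (x ∷ xs) (i ∸ 1) C part (x ∷ xs) i))
    b = _/_ (q !) (denominator (x ∷ xs)) {{denominator≢0 (x ∷ xs)}}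

theorem6p4 : (n q s : ℕ) → n ≥ 1 → q ≥ 1 → s ≥ 2 →
    C-B n q s ≡ (∑[ λs ∈ admissible n q s ] summand n q s λs)
theorem6p4 n q s n≥1 q≥1 s≥2 = begin
  C-B n q s
    ≡⟨ C-B≡loadSum n q s ⟩
  loadSum n q (weight q s)
    ≡⟨ loadSum-partitions q q n q ≤-refl ≤-refl (weight-symmetric q s) ⟨
  (∑[ λs ∈ listsUpTo q q ] restrict (sum λs ≟ℕ q) (chainWeight n λs * weight q s (conjugate n λs)))
    ≡⟨ ∑-cong-∈ (listsUpTo q q) (λ {λs} λs∈ →
         restrict-admissible n q s λs q≥1 (<⇒≤ s≥2) (listsUpTo-positive q q λs∈)) ⟨
  (∑[ λs ∈ listsUpTo q q ] restrict (isPartition? q λs) (restrict (ok? λs) (summand n q s λs)))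
    ≡⟨ ∑-filter (isPartition? q) (listsUpTo q q) _ ⟨
  (∑[ λs ∈ partitions q ] restrict (ok? λs) (summand n q s λs))
    ≡⟨ ∑-filter ok? (partitions q) (summand n q s) ⟨
  (∑[ λs ∈ admissible n q s ] summand n q s λs)
    ∎
  where
  ok? : ∀ λs → Dec (part λs 1 ≤ n × length λs ≥ s)
  ok? λs = (part λs 1 ≤? n) ×-dec (length λs ≥? s)
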